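{- Setting $b=d=g=\ell=q$, $s=xq$, $p=u=x$, and all other parameters ($a,c,f,h,r,t,w$) equal to $1$ in $\mathcal C$, one has $$\mathcal C(z)=1+\sum_{n\ge1}\sum_{\sigma\in\mathcal S_n}x^{\mathsf{des}(\sigma)+1}q^{\mathsf{occ}_{2\text{ - }31}(\sigma)}z^n .$$
   Context: $\mathcal S_n$ is the set of permutations of $[n]=\{1,\dots,n\}$. $\mathsf{des}(\sigma)$ is the number of descents of $\sigma$, i.e. of $i\in[n-1]$ with $\sigma(i)>\sigma(i+1)$. $\mathsf{occ}_{2\text{ - }31}(\sigma)$ is the number of occurrences of the vincular pattern $2\text{ - }31$ in $\sigma$, i.e. the number of pairs $(i,j)$ with $1\le i<j\le n-1$ and $\sigma(j+1)<\sigma(i)<\sigma(j)$. For $n\ge1$, $[n]_{x,y}:=\sum_{i=0}^{n-1}x^{n-1-i}y^{i}$, and $[0]_{x,y}:=0$, with the convention $0^0=1$. For parameters $a,b,c,d,f,g,h,\ell,p,r,s,t,u,w$, $\mathcal C(z)$ is the formal power series in $z$ defined by the continued fraction $$\mathcal C(z)=\cfrac{1}{1-\alpha_0z-\cfrac{\beta_1z^2}{1-\alpha_1z-\cfrac{\beta_2z^2}{\ddots}}},\qquad \alpha_n=u\,w^n+s\,[n]_{a,b}+t\,[n]_{f,g}\ (n\ge 0),\quad \beta_n=p\,r\,[n]_{c,d}\,[n]_{h,\ell}\ (n\ge 1).$$ -}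

module Defs where

open import Algebra.Bundles using (CommutativeRing)
open import Data.Fin.Base as Fin using (Fin; toℕ; inject₁)
import Data.Fin.Properties as Fin
open import Data.Fin.Permutation as Perm using (Permutation′; _⟨$⟩ʳ_)
open import Data.List.Base as List
  using (List; []; _∷_; filter; length; allFin; cartesianProduct; cartesianProductWith)
open import Data.List.Membership.Propositional using (_∈_)
import Data.List.Membership.Propositional.Properties as Mem
open import Data.List.Relation.Unary.All as All using (All; []; _∷_)
import Data.List.Relation.Unary.All.Properties as All
open import Data.List.Relation.Unary.Any using (here; there)
open import Data.List.Relation.Unary.AllPairs as AllPairs using (AllPairs; []; _∷_)
import Data.List.Relation.Unary.AllPairs.Properties as AllPairs
open import Data.List.Relation.Unary.Unique.Propositional.Properties using (allFin⁺)
open import Data.Nat.Base as ℕ using (ℕ; zero; suc; _∸_)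
import Data.Nat.Properties as ℕ
open import Data.Product.Base using (_×_; _,_; ∃-syntax)
open import Data.Vec.Functional as Vector using (Vector)
open import Function.Base using (_∘_)
open import Relation.Binary.PropositionalEquality.Core as ≡ using (_≡_; _≢_)
open import Relation.Nullary.Decidable using (_×-dec_)
open import Relation.Nullary.Negation using (¬_)

------------------------------------------------------------------------
-- Permutations

-- S n lists every permutation exactly once up to pointwise equality
-- (S-complete, S-unique): σ is determined by σ(1) and by the pattern of
-- its remaining values.

S : ∀ n → List (Permutation′ n)
S zero    = Perm.id ∷ []
S (suc n) = cartesianProductWith (Perm.insert Fin.zero) (allFin (suc n)) (S n)

private
  insert-cong : ∀ {n} (j : Fin (suc n)) {π ρ : Permutation′ n} → π Perm.≈ ρ →
                Perm.insert Fin.zero j π Perm.≈ Perm.insert Fin.zero j ρ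
  insert-cong j         π≈ρ Fin.zero    = ≡.refl
  insert-cong j {π} {ρ} π≈ρ (Fin.suc k) =
    ≡.trans (Perm.insert-punchIn Fin.zero j π k)
      (≡.trans (≡.cong (Fin.punchIn j) (π≈ρ k))
               (≡.sym (Perm.insert-punchIn Fin.zero j ρ k)))

  insert-injective : ∀ {n} (j : Fin (suc n)) {π ρ : Permutation′ n} →
                     Perm.insert Fin.zero j π Perm.≈ Perm.insert Fin.zero j ρ →
                     π Perm.≈ ρ
  insert-injective j {π} {ρ} eq k = Fin.punchIn-injective j _ _
    (≡.trans (≡.sym (Perm.insert-punchIn Fin.zero j π k))
      (≡.trans (eq (Fin.suc k)) (Perm.insert-punchIn Fin.zero j ρ k)))

S-complete : ∀ {n} (σ : Permutation′ n) → ∃[ π ] π ∈ S n × π Perm.≈ σ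
S-complete {zero}  σ = Perm.id , here ≡.refl , λ ()
S-complete {suc n} σ with S-complete (Perm.remove Fin.zero σ)
... | π , π∈S , π≈ =
  Perm.insert Fin.zero (σ ⟨$⟩ʳ Fin.zero) π ,
  Mem.∈-cartesianProductWith⁺ (Perm.insert Fin.zero) (Mem.∈-allFin _) π∈S ,
  λ k → ≡.trans (insert-cong _ {π} {Perm.remove Fin.zero σ} π≈ k)
                (Perm.insert-remove Fin.zero σ k)

S-unique : ∀ n → AllPairs (λ π ρ → ¬ (π Perm.≈ ρ)) (S n)
S-unique zero    = [] ∷ []
S-unique (suc n) = go (allFin (suc n)) (allFin⁺ (suc n))
  where
  ins = Perm.insert {n} {n} Fin.zero

  apart : ∀ {j} π (ks : List (Fin (suc n))) → All (j ≢_) ks →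
          All (λ ρ → ¬ (ins j π Perm.≈ ρ)) (cartesianProductWith ins ks (S n))
  apart π []       []           = []
  apart π (k ∷ ks) (j≢k ∷ j≢ks) =
    All.++⁺ (All.map⁺ (All.universal (λ ρ eq → j≢k (eq Fin.zero)) (S n)))
            (apart π ks j≢ks)

  go : ∀ js → AllPairs _≢_ js →
       AllPairs (λ π ρ → ¬ (π Perm.≈ ρ)) (cartesianProductWith ins js (S n))
  go []       []           = []
  go (j ∷ js) (j≢js ∷ js!) = AllPairs.++⁺
    (AllPairs.map⁺ (AllPairs.map (λ {π} {ρ} π≉ρ → π≉ρ ∘ insert-injective j {π} {ρ}) (S-unique n)))
    (go js js!)
    (All.map⁺ (All.universal (λ π → apart π js j≢js) (S n)))

-- For n = suc m, the index set [n-1] is Fin m; the positions i and i+1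
-- are inject₁ i and suc i.

des : ∀ {m} → Permutation′ (suc m) → ℕ
des {m} σ =
  length (filter (λ i → (σ ⟨$⟩ʳ Fin.suc i) Fin.<? (σ ⟨$⟩ʳ inject₁ i)) (allFin m))

occ₂₋₃₁ : ∀ {m} → Permutation′ (suc m) → ℕ
occ₂₋₃₁ {m} σ =
  length (filter (λ (i , j) → (i Fin.<? j)
                       ×-dec ((σ ⟨$⟩ʳ Fin.suc j) Fin.<? (σ ⟨$⟩ʳ inject₁ i))
                       ×-dec ((σ ⟨$⟩ʳ inject₁ i) Fin.<? (σ ⟨$⟩ʳ inject₁ j)))
                 (cartesianProduct (allFin m) (allFin m)))

------------------------------------------------------------------------
-- Formal power series and continued fractions over a commutative ring

module PowerSeries {r₁ r₂} (R : CommutativeRing r₁ r₂) where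

  open CommutativeRing R
  open import Algebra.Properties.Semiring.Sum semiring
    using (sum-syntax; sum⁺-syntax; sum-cong-≋)
  open import Algebra.Properties.Semiring.Exp semiring using (_^_)
  open import Relation.Binary.Reasoning.Setoid setoid

  -- A n is the coefficient of zⁿ.
  Series : Set r₁
  Series = ℕ → Carrier

  infix 4 _≋_
  _≋_ : Series → Series → Set r₂
  A ≋ B = ∀ n → A n ≈ B n

  𝟘 : Series
  𝟘 _ = 0#

  𝟙 : Series
  𝟙 zero    = 1#
  𝟙 (suc _) = 0#

  infixl 6 _⊖_
  _⊖_ : Series → Series → Series
  (A ⊖ B) n = A n - B n

  infixl 7 _⊛_
  _⊛_ : Series → Series → Series
  (A ⊛ B) n = ∑[ i ≤ n ] (A (toℕ i) * B (n ∸ toℕ i))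

  infixr 8 _•_ z·_
  _•_ : Carrier → Series → Series
  (x • A) n = x * A n

  z·_ : Series → Series
  (z· A) zero    = 0#
  (z· A) (suc n) = A n

  -- inverseCoeffs A n is the vector of the coefficients of zⁿ, …, z¹, z⁰
  -- in 1/A, for A with constant term 1.
  inverseCoeffs : Series → ∀ n → Vector Carrier (suc n)
  inverseCoeffs A zero    = 1# Vector.∷ Vector.[]
  inverseCoeffs A (suc n) =
    (- (∑[ i ≤ n ] (A (suc (toℕ i)) * inverseCoeffs A n i))) Vector.∷ inverseCoeffs A n

  -- Only meaningful when A has constant term 1; see ⊛-inverse.
  1/_ : Series → Series
  (1/ A) n = inverseCoeffs A n Fin.zero

  private
    inverseCoeffs-1/ : ∀ A n i → inverseCoeffs A n i ≡ (1/ A) (n ∸ toℕ i)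
    inverseCoeffs-1/ A zero    Fin.zero    = ≡.refl
    inverseCoeffs-1/ A (suc n) Fin.zero    = ≡.refl
    inverseCoeffs-1/ A (suc n) (Fin.suc i) = inverseCoeffs-1/ A n i

  ⊛-inverse : ∀ A → A 0 ≈ 1# → A ⊛ (1/ A) ≋ 𝟙
  ⊛-inverse A A₀≈1 zero = begin
    A 0 * 1# + 0#  ≈⟨ +-identityʳ _ ⟩
    A 0 * 1#       ≈⟨ *-identityʳ _ ⟩
    A 0            ≈⟨ A₀≈1 ⟩
    1#             ∎
  ⊛-inverse A A₀≈1 (suc n) = begin
    A 0 * (- T) + ∑[ i ≤ n ] (A (suc (toℕ i)) * (1/ A) (n ∸ toℕ i))
      ≈⟨ +-cong (trans (*-congʳ A₀≈1) (*-identityˡ _))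
                (sum-cong-≋ (λ i → *-congˡ {A (suc (toℕ i))}
                  (sym (reflexive (inverseCoeffs-1/ A n i))))) ⟩
    - T + T
      ≈⟨ -‿inverseˡ T ⟩
    0# ∎
    where
    T = ∑[ i ≤ n ] (A (suc (toℕ i)) * inverseCoeffs A n i)

  -- 1 - α₀ z - β₁ z² T
  denominator : (α β : ℕ → Carrier) → Series → Series
  denominator α β T = 𝟙 ⊖ α 0 • z· 𝟙 ⊖ β 1 • z· z· T

  -- The continued fraction cut off (tail replaced by 0) after m levels.
  convergent : (α β : ℕ → Carrier) → ℕ → Series
  convergent α β zero    = 𝟘
  convergent α β (suc m) = 1/ denominator α β (convergent (α ∘ suc) (β ∘ suc) m)

  -- The infinite continued fraction is the limit of its convergents: the
  -- coefficient of zⁿ is constant from the (n+1)-st convergent on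
  -- (convergent-limit), and the defining recursion holds (J-unfold).
  J : (α β : ℕ → Carrier) → Series
  J α β n = convergent α β (suc n) n

  private
    Agree : ℕ → Series → Series → Set r₂
    Agree n A B = ∀ {i} → i ℕ.< n → A i ≈ B i

    inverseCoeffs-cong : ∀ {A B} n → Agree (suc n) A B →
                         ∀ i → inverseCoeffs A n i ≈ inverseCoeffs B n i
    inverseCoeffs-cong zero    A≈B Fin.zero    = refl
    inverseCoeffs-cong (suc n) A≈B Fin.zero    = -‿cong (sum-cong-≋ λ i →
      *-cong (A≈B (ℕ.s≤s (Fin.toℕ<n i))) (inverseCoeffs-cong n (A≈B ∘ ℕ.m<n⇒m<1+n) i))
    inverseCoeffs-cong (suc n) A≈B (Fin.suc i) =
      inverseCoeffs-cong n (A≈B ∘ ℕ.m<n⇒m<1+n) i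

    denominator-cong : ∀ α β {S T m} → Agree m S T →
                       Agree (suc m) (denominator α β S) (denominator α β T)
    denominator-cong α β S≈T {zero}        _ = refl
    denominator-cong α β S≈T {suc zero}    _ = refl
    denominator-cong α β S≈T {suc (suc i)} (ℕ.s≤s i<m) =
      +-congˡ (-‿cong (*-congˡ (S≈T (ℕ.<-trans (ℕ.n<1+n i) i<m))))

    convergent-stable : ∀ α β {m k} → m ℕ.≤ k →
                        Agree m (convergent α β m) (convergent α β k)
    convergent-stable α β (ℕ.s≤s m≤k) {i} i<m = inverseCoeffs-cong i
      (λ j≤i → denominator-cong α β (convergent-stable (α ∘ suc) (β ∘ suc) m≤k)
                                (ℕ.<-≤-trans j≤i i<m))
      Fin.zero

  convergent-limit : ∀ α β n {m} → n ℕ.< m → convergent α β m n ≈ J α β n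
  convergent-limit α β n n<m = sym (convergent-stable α β n<m (ℕ.n<1+n n))

  J-unfold : ∀ α β → denominator α β (J (α ∘ suc) (β ∘ suc)) ⊛ J α β ≋ 𝟙
  J-unfold α β n = trans
    (sum-cong-≋ λ i → *-cong
      (denominator-cong α β {m = n}
        (λ {j} j<n → sym (convergent-limit (α ∘ suc) (β ∘ suc) j j<n))
        (Fin.toℕ<n i))
      (sym (convergent-limit α β (n ∸ toℕ i) (ℕ.s≤s (ℕ.m∸n≤m n (toℕ i))))))
    (⊛-inverse (denominator α β (convergent (α ∘ suc) (β ∘ suc) n)) D₀≈1 n)
    where
    x-c0≈x : ∀ x c → x - c * 0# ≈ x
    x-c0≈x x c = begin
      x - c * 0#       ≈⟨ +-congˡ (-‿cong (zeroʳ c)) ⟩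
      x - 0#           ≈⟨ +-congʳ (sym (+-identityʳ x)) ⟩
      (x + 0#) - 0#    ≈⟨ +-assoc x 0# (- 0#) ⟩
      x + (0# - 0#)    ≈⟨ +-congˡ (-‿inverseʳ 0#) ⟩
      x + 0#           ≈⟨ +-identityʳ x ⟩
      x                ∎
    D₀≈1 = trans (x-c0≈x _ _) (x-c0≈x _ _)

  [_]⟨_,_⟩ : ℕ → Carrier → Carrier → Carrier
  [ n ]⟨ x , y ⟩ = ∑[ i < n ] (x ^ (n ∸ 1 ∸ toℕ i) * y ^ toℕ i)

  record Parameters : Set r₁ where
    field
      a b c d f g h ℓ p r s t u w : Carrier

  module _ (P : Parameters) where
    open Parameters P

    αᶜ : ℕ → Carrier
    αᶜ n = u * w ^ n + s * [ n ]⟨ a , b ⟩ + t * [ n ]⟨ f , g ⟩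

    βᶜ : ℕ → Carrier
    βᶜ n = p * r * [ n ]⟨ c , d ⟩ * [ n ]⟨ h , ℓ ⟩

    𝒞 : Series
    𝒞 = J αᶜ βᶜ

  specialisation : (x q : Carrier) → Parameters
  specialisation x q = record
    { a = 1# ; b = q
    ; c = 1# ; d = q
    ; f = 1# ; g = q
    ; h = 1# ; ℓ = q
    ; p = x  ; r = 1#
    ; s = x * q ; t = 1#
    ; u = x  ; w = 1#
    }

  ∑S : ∀ n → (Permutation′ n → Carrier) → Carrier
  ∑S n F = List.foldr _+_ 0# (List.map F (S n))

  -- 1 + Σ_{n≥1} Σ_{σ ∈ S n} x^(des σ + 1) q^(occ₂₋₃₁ σ) zⁿ
  des-occ-series : (x q : Carrier) → Series
  des-occ-series x q zero    = 1#
  des-occ-series x q (suc m) =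
    ∑S (suc m) (λ σ → x ^ (des σ ℕ.+ 1) * q ^ occ₂₋₃₁ σ)

-- Read a permutation from its first entry on.  The total weight of all ways to
-- continue depends on the current entry and on which values have been used, and it
-- can be computed by scanning the values in increasing order while keeping track
-- of the number h of blocks already formed by the values still to be placed.  A free
-- value acts on functions of h by N₀ = C B below the current entry and by
-- N₁ = C (B + Q) above it, a used value by Q, the current entry by A = C Q.  That
-- this product satisfies the recursion of the total weight (sum over the
-- next entry) amounts to the relations N₁ = N₀ + A and
-- shift N₁ + x A = N₀ shift, in both of which A is the operator of the current
-- entry.  For permutations of [n] one gets the value (C B)ⁿ C δ at h = 0, while
-- the continued fraction enumerates Motzkin paths with transfer operator B C and
-- gives (B C)ⁿ δ at h = 0; the two agree because (C B)ⁿ C = C (B C)ⁿ.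

module Submission where

open import Algebra.Bundles using (CommutativeRing)
import Algebra.Properties.CommutativeMonoid.Sum
import Algebra.Properties.Monoid.Sum
import Algebra.Properties.Ring
import Algebra.Properties.Semiring.Exp
import Algebra.Properties.Semiring.Sum
import Algebra.Solver.Ring.NaturalCoefficients.Default
open import Data.Bool.Base using (true; false; if_then_else_)
open import Data.Bool.Properties using (∧-zeroʳ)
open import Data.Fin.Base as Fin using (Fin; toℕ; zero; suc; inject₁; punchIn; fromℕ)
import Data.Fin.Properties as Fin
open import Data.Fin.Permutation using (Permutation′; insert; insert-punchIn; _⟨$⟩ʳ_)
open import Data.List.Base as List
  using ([]; _∷_; _++_; map; filter; length; tabulate; cartesianProduct)
open import Data.List.Properties as List using (filter-++; length-++; map-tabulate)
open import Data.Nat.Base as ℕ using (ℕ; zero; suc)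
import Data.Nat.Properties as ℕ
open import Data.Product.Base using (_×_; _,_)
open import Function.Base using (_∘_; id)
import Relation.Binary.PropositionalEquality as ≡
open ≡ using (_≡_)
import Relation.Binary.Reasoning.Setoid
open import Relation.Nullary.Decidable using (Dec; does; _×-dec_)
open import Relation.Unary using (Pred; Decidable)

open import Defs

private module ℕ∑ = Algebra.Properties.Monoid.Sum ℕ.+-0-monoid

-- Counting descents and occurrences

indicator : ∀ {p} {P : Set p} → Dec P → ℕ
indicator P? = if does P? then 1 else 0

length-filter-tabulate : ∀ {a p} {A : Set a} {P : Pred A p} (P? : Decidable P) {n} (f : Fin n → A) →
  length (filter P? (tabulate f)) ≡ ℕ∑.sum (λ i → indicator (P? (f i)))
length-filter-tabulate P? {zero}  f = ≡.refl
length-filter-tabulate P? {suc n} f with does (P? (f zero))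
... | true  = ≡.cong suc (length-filter-tabulate P? (f ∘ suc))
... | false = length-filter-tabulate P? (f ∘ suc)

length-filter-cartesianProduct :
  ∀ {a b p} {A : Set a} {B : Set b} {P : Pred (A × B) p} (P? : Decidable P)
  {m n} (f : Fin m → A) (g : Fin n → B) →
  length (filter P? (cartesianProduct (tabulate f) (tabulate g))) ≡
  ℕ∑.sum (λ i → ℕ∑.sum (λ j → indicator (P? (f i , g j))))
length-filter-cartesianProduct P? {zero}  f g = ≡.refl
length-filter-cartesianProduct P? {suc m} f g = begin
  length (filter P? (row ++ rest))
    ≡⟨ ≡.cong length (filter-++ P? row rest) ⟩
  length (filter P? row ++ filter P? rest)
    ≡⟨ length-++ (filter P? row) ⟩
  length (filter P? row) ℕ.+ length (filter P? rest)
    ≡⟨ ≡.cong₂ ℕ._+_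
         (≡.trans (≡.cong (length ∘ filter P?) (map-tabulate g (f zero ,_)))
                (length-filter-tabulate P? (λ j → f zero , g j)))
         (length-filter-cartesianProduct P? (f ∘ suc) g) ⟩
  ℕ∑.sum (λ j → indicator (P? (f zero , g j))) ℕ.+
  ℕ∑.sum (λ i → ℕ∑.sum (λ j → indicator (P? (f (suc i) , g j)))) ∎
  where
  open ≡.≡-Reasoning
  row  = map (f zero ,_) (tabulate g)
  rest = cartesianProduct (tabulate (f ∘ suc)) (tabulate g)

-- Here `j` is the value playing the 2, and `k`, `l` are the adjacent later values playing the 31.
crosses? : ∀ {n} (j k l : Fin n) → Dec (l Fin.< j × j Fin.< k)
crosses? j k l = (l Fin.<? j) ×-dec (j Fin.<? k)

punchIn-<? : ∀ {n} (j : Fin (suc n)) k l →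
             does (punchIn j k Fin.<? punchIn j l) ≡ does (k Fin.<? l)
punchIn-<? zero    k       l       = ≡.refl
punchIn-<? (suc j) zero    zero    = ≡.refl
punchIn-<? (suc j) zero    (suc l) = ≡.refl
punchIn-<? (suc j) (suc k) zero    = ≡.refl
punchIn-<? (suc j) (suc k) (suc l) = punchIn-<? j k l

des-sum : ∀ {n} (σ : Permutation′ (suc n)) →
  des σ ≡ ℕ∑.sum (λ k → indicator ((σ ⟨$⟩ʳ suc k) Fin.<? (σ ⟨$⟩ʳ inject₁ k)))
des-sum σ = length-filter-tabulate (λ i → (σ ⟨$⟩ʳ suc i) Fin.<? (σ ⟨$⟩ʳ inject₁ i)) id

occ-sum : ∀ {n} (σ : Permutation′ (suc n)) →
  occ₂₋₃₁ σ ≡ ℕ∑.sum (λ i → ℕ∑.sum (λ j → indicator ((i Fin.<? j) ×-dec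
    crosses? (σ ⟨$⟩ʳ inject₁ i) (σ ⟨$⟩ʳ inject₁ j) (σ ⟨$⟩ʳ suc j))))
occ-sum σ = length-filter-cartesianProduct (λ (i , j) → (i Fin.<? j) ×-dec
  crosses? (σ ⟨$⟩ʳ inject₁ i) (σ ⟨$⟩ʳ inject₁ j) (σ ⟨$⟩ʳ suc j)) id id

module _ {n} (j : Fin (suc (suc n))) (π : Permutation′ (suc n)) where

  crossing : Fin n → ℕ
  crossing k = indicator (crosses? j (punchIn j (π ⟨$⟩ʳ inject₁ k)) (punchIn j (π ⟨$⟩ʳ suc k)))

  -- The first entry can only play the 2 of an occurrence; all other occurrences lie in the rest,
  -- whose relative order is preserved by `punchIn j`.
  occ-insert : occ₂₋₃₁ (insert zero j π) ≡ ℕ∑.sum crossing ℕ.+ occ₂₋₃₁ π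
  occ-insert = begin
    occ₂₋₃₁ σ
      -- Terms whose second position is `zero` reduce to 0; this leaves the row of the first
      -- position and a shifted double sum.
      ≡⟨ occ-sum σ ⟩
    ℕ∑.sum (λ k → indicator (crosses? j (σ ⟨$⟩ʳ suc (inject₁ k)) (σ ⟨$⟩ʳ suc (suc k)))) ℕ.+
    ℕ∑.sum (λ i → ℕ∑.sum (λ k → indicator ((i Fin.<? k) ×-dec
      crosses? (σ ⟨$⟩ʳ suc (inject₁ i)) (σ ⟨$⟩ʳ suc (inject₁ k)) (σ ⟨$⟩ʳ suc (suc k)))))
      ≡⟨ ≡.cong₂ ℕ._+_
           (ℕ∑.sum-cong-≗ {n} λ k → ≡.cong₂ (λ a b → indicator (crosses? j a b))
                                       (σ-suc (inject₁ k)) (σ-suc (suc k)))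
           (ℕ∑.sum-cong-≗ {n} λ i → ℕ∑.sum-cong-≗ {n} λ k → later i k) ⟩
    ℕ∑.sum crossing ℕ.+
    ℕ∑.sum (λ i → ℕ∑.sum (λ k → indicator ((i Fin.<? k) ×-dec
      crosses? (π ⟨$⟩ʳ inject₁ i) (π ⟨$⟩ʳ inject₁ k) (π ⟨$⟩ʳ suc k))))
      ≡⟨ ≡.cong (ℕ∑.sum crossing ℕ.+_) (occ-sum π) ⟨
    ℕ∑.sum crossing ℕ.+ occ₂₋₃₁ π ∎
    where
    open ≡.≡-Reasoning
    σ = insert zero j π
    σ-suc : ∀ k → σ ⟨$⟩ʳ suc k ≡ punchIn j (π ⟨$⟩ʳ k)
    σ-suc = insert-punchIn zero j π
    later : ∀ i k →
      indicator ((i Fin.<? k) ×-dec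
        crosses? (σ ⟨$⟩ʳ suc (inject₁ i)) (σ ⟨$⟩ʳ suc (inject₁ k)) (σ ⟨$⟩ʳ suc (suc k))) ≡
      indicator ((i Fin.<? k) ×-dec
        crosses? (π ⟨$⟩ʳ inject₁ i) (π ⟨$⟩ʳ inject₁ k) (π ⟨$⟩ʳ suc k))
    later i k
      rewrite σ-suc (inject₁ i) | σ-suc (inject₁ k) | σ-suc (suc k)
            | punchIn-<? j (π ⟨$⟩ʳ suc k) (π ⟨$⟩ʳ inject₁ i)
            | punchIn-<? j (π ⟨$⟩ʳ inject₁ i) (π ⟨$⟩ʳ inject₁ k) = ≡.refl

-- Partially read permutations

-- The values of a permutation whose first few entries are known, in increasing
-- order: a value is used if it has occurred, and free otherwise.
data Letters : ℕ → Set where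
  []   : Letters 0
  free : ∀ {n} → Letters n → Letters (suc n)
  used : ∀ {n} → Letters n → Letters n

use : ∀ {n} → Letters (suc n) → Fin (suc n) → Letters n
use         (used w) j       = used (use w j)
use         (free w) zero    = used w
use {suc n} (free w) (suc j) = free (use w j)

below : ∀ {n} → Letters n → Fin n → ℕ
below (used w) j       = suc (below w j)
below (free w) zero    = 0
below (free w) (suc j) = below w j

below-use : ∀ {n} (w : Letters (suc n)) j k →
  below (use w j) k ≡ indicator (j Fin.<? punchIn j k) ℕ.+ below w (punchIn j k)
below-use         (used w) j       k       =
  ≡.trans (≡.cong suc (below-use w j k)) (≡.sym (ℕ.+-suc _ _))
below-use         (free w) zero    k       = ≡.refl
below-use {suc n} (free w) (suc j) zero    = ≡.refl
below-use {suc n} (free w) (suc j) (suc k) = below-use w j k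

allFree : ∀ n → Letters n
allFree zero    = []
allFree (suc n) = free (allFree n)

below-allFree : ∀ {n} k → below (allFree n) k ≡ 0
below-allFree {suc n} zero    = ≡.refl
below-allFree {suc n} (suc k) = below-allFree k

below-use-allFree : ∀ {n} k → below (use (allFree (suc n)) (fromℕ n)) k ≡ 0
below-use-allFree {suc n} zero    = ≡.refl
below-use-allFree {suc n} (suc k) = below-use-allFree k

module _ {r₁ r₂} (R : CommutativeRing r₁ r₂) where

  open CommutativeRing R hiding (zero)
  open PowerSeries R
  open Algebra.Properties.Semiring.Sum semiring
    using (sum-syntax; sum-cong-≋; *-distribˡ-sum; sum-init-last)
  open Algebra.Properties.Semiring.Exp semiring using (_^_; ^-homo-*; ^-congʳ)
  open Algebra.Properties.Ring ring using (-0#≈0#; +-inverseˡ-unique; +-inverseʳ-unique)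
  open Algebra.Solver.Ring.NaturalCoefficients.Default commutativeSemiring
    using (solve; _:+_; _:*_; _:=_; con)
  open Relation.Binary.Reasoning.Setoid setoid
  private module ∏ = Algebra.Properties.CommutativeMonoid.Sum *-commutativeMonoid

  -- Continued fractions and Motzkin paths

  ⊛-cong : ∀ {A A′ B B′} → A ≋ A′ → B ≋ B′ → A ⊛ B ≋ A′ ⊛ B′
  ⊛-cong A≋A′ B≋B′ n = sum-cong-≋ {suc n} λ i → *-cong (A≋A′ (toℕ i)) (B≋B′ (n ℕ.∸ toℕ i))

  ⊛-zero : ∀ {A} B → A ≋ 𝟘 → A ⊛ B ≋ 𝟘
  ⊛-zero B A≋𝟘 zero    = trans (+-identityʳ _) (trans (*-congʳ (A≋𝟘 0)) (zeroˡ _))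
  ⊛-zero B A≋𝟘 (suc n) =
    trans (+-cong (trans (*-congʳ (A≋𝟘 0)) (zeroˡ _)) (⊛-zero B (A≋𝟘 ∘ suc) n)) (+-identityˡ _)

  ⊛-identityˡ : ∀ B → 𝟙 ⊛ B ≋ B
  ⊛-identityˡ B zero    = trans (+-identityʳ _) (*-identityˡ _)
  ⊛-identityˡ B (suc n) =
    trans (+-cong (*-identityˡ _) (⊛-zero B (λ _ → refl) n)) (+-identityʳ _)

  -- By definition `(A ⊛ B) (suc n)` is `A 0 * B (suc n) + ((A ∘ suc) ⊛ B) n`, so the induction
  -- shortens the left factor. The combination `c * A i + B i` is the shape of the tail of a
  -- product, as required for associativity.
  ⊛-linearˡ : ∀ c A B C n → ((λ i → c * A i + B i) ⊛ C) n ≈ c * (A ⊛ C) n + (B ⊛ C) n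
  ⊛-linearˡ c A B C zero    =
    solve 4 (λ c a b x → (c :* a :+ b) :* x :+ con 0 := c :* (a :* x :+ con 0) :+ (b :* x :+ con 0))
      refl c (A 0) (B 0) (C 0)
  ⊛-linearˡ c A B C (suc n) = trans (+-congˡ (⊛-linearˡ c (A ∘ suc) (B ∘ suc) C n))
    (solve 6 (λ c a b x u v → (c :* a :+ b) :* x :+ (c :* u :+ v) := c :* (a :* x :+ u) :+ (b :* x :+ v))
      refl c (A 0) (B 0) (C (suc n)) (((A ∘ suc) ⊛ C) n) (((B ∘ suc) ⊛ C) n))

  ⊛-•ˡ : ∀ c A B → (c • A) ⊛ B ≋ c • (A ⊛ B)
  ⊛-•ˡ c A B n = begin
    ((c • A) ⊛ B) n
      ≈⟨ ⊛-cong {B = B} (λ i → +-identityʳ (c * A i)) (λ _ → refl) n ⟨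
    ((λ i → c * A i + 0#) ⊛ B) n
      ≈⟨ ⊛-linearˡ c A 𝟘 B n ⟩
    c * (A ⊛ B) n + (𝟘 ⊛ B) n
      ≈⟨ +-congˡ (⊛-zero B (λ _ → refl) n) ⟩
    c * (A ⊛ B) n + 0#
      ≈⟨ +-identityʳ _ ⟩
    c * (A ⊛ B) n ∎

  ⊛-assoc : ∀ A B C → (A ⊛ B) ⊛ C ≋ A ⊛ (B ⊛ C)
  ⊛-assoc A B C zero    =
    solve 3 (λ a b c → (a :* b :+ con 0) :* c :+ con 0 := a :* (b :* c :+ con 0) :+ con 0)
      refl (A 0) (B 0) (C 0)
  ⊛-assoc A B C (suc n) = begin
    (A 0 * B 0 + 0#) * C (suc n) + (((A ⊛ B) ∘ suc) ⊛ C) n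
      ≈⟨ +-congˡ (⊛-linearˡ (A 0) (B ∘ suc) ((A ∘ suc) ⊛ B) C n) ⟩
    (A 0 * B 0 + 0#) * C (suc n) + (A 0 * ((B ∘ suc) ⊛ C) n + (((A ∘ suc) ⊛ B) ⊛ C) n)
      ≈⟨ +-congˡ (+-congˡ (⊛-assoc (A ∘ suc) B C n)) ⟩
    (A 0 * B 0 + 0#) * C (suc n) + (A 0 * ((B ∘ suc) ⊛ C) n + ((A ∘ suc) ⊛ (B ⊛ C)) n)
      ≈⟨ solve 5 (λ a b c u v → (a :* b :+ con 0) :* c :+ (a :* u :+ v) := a :* (b :* c :+ u) :+ v)
           refl (A 0) (B 0) (C (suc n)) _ _ ⟩
    A 0 * (B 0 * C (suc n) + ((B ∘ suc) ⊛ C) n) + ((A ∘ suc) ⊛ (B ⊛ C)) n ∎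

  z·-cong : ∀ {A B} → A ≋ B → z· A ≋ z· B
  z·-cong A≋B zero    = refl
  z·-cong A≋B (suc n) = A≋B n

  z·-• : ∀ c A → z· c • A ≋ c • z· A
  z·-• c A zero    = sym (zeroʳ c)
  z·-• c A (suc n) = refl

  ⊛-z·ˡ : ∀ A B → (z· A) ⊛ B ≋ z· (A ⊛ B)
  ⊛-z·ˡ A B zero    = trans (+-identityʳ _) (zeroˡ _)
  ⊛-z·ˡ A B (suc n) = trans (+-congʳ (zeroˡ _)) (+-identityˡ _)

  ⊛-z·•ʳ : ∀ A c B → A ⊛ (z· c • B) ≋ z· c • (A ⊛ B)
  ⊛-z·•ʳ A c B zero          = trans (+-identityʳ _) (zeroʳ _)
  ⊛-z·•ʳ A c B (suc zero)    =
    solve 4 (λ a a′ c b → a :* (c :* b) :+ (a′ :* con 0 :+ con 0) := c :* (a :* b :+ con 0))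
      refl (A 0) (A 1) c (B 0)
  ⊛-z·•ʳ A c B (suc (suc n)) = trans (+-congˡ (⊛-z·•ʳ (A ∘ suc) c B (suc n)))
    (solve 4 (λ a c b u → a :* (c :* b) :+ c :* u := c :* (a :* b :+ u)) refl (A 0) c _ _)

  module _ (α β : ℕ → Carrier) where

    private
      T = J (α ∘ suc) (β ∘ suc)

      D₀≈1 : denominator α β T 0 ≈ 1#
      D₀≈1 = begin
        1# - α 0 * 0# - β 1 * 0#  ≈⟨ +-cong (+-congˡ (-‿cong (zeroʳ _))) (-‿cong (zeroʳ _)) ⟩
        1# - 0# - 0#              ≈⟨ +-cong (+-congˡ -0#≈0#) -0#≈0# ⟩
        1# + 0# + 0#              ≈⟨ trans (+-identityʳ _) (+-identityʳ _) ⟩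
        1#                        ∎

      cancel : ∀ a b → 1# * (0# - a - b) + (a + b) ≈ 0#
      cancel a b = begin
        1# * (0# - a - b) + (a + b)
          ≈⟨ +-congʳ (*-identityˡ _) ⟩
        0# - a - b + (a + b)
          ≈⟨ solve 4 (λ a b a⁻ b⁻ → con 0 :+ a⁻ :+ b⁻ :+ (a :+ b) := (a⁻ :+ a) :+ (b⁻ :+ b))
               refl a b (- a) (- b) ⟩
        (- a + a) + (- b + b)
          ≈⟨ +-cong (-‿inverseˡ a) (-‿inverseˡ b) ⟩
        0# + 0#
          ≈⟨ +-identityˡ 0# ⟩
        0# ∎

    J-zero : J α β 0 ≈ 1#
    J-zero = begin
      J α β 0                               ≈⟨ *-identityˡ _ ⟨
      1# * J α β 0                          ≈⟨ *-congʳ D₀≈1 ⟨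
      denominator α β T 0 * J α β 0         ≈⟨ +-identityʳ _ ⟨
      (denominator α β T ⊛ J α β) 0         ≈⟨ J-unfold α β 0 ⟩
      1#                                    ∎

    J-suc : ∀ n → J α β (suc n) ≈ α 0 * J α β n + β 1 * (z· (T ⊛ J α β)) n
    J-suc n = begin
      J α β (suc n)
        -- `D` is the tail of the denominator and `E` its negative, so both sides are the additive
        -- inverse of `(D ⊛ J α β) n`.
        ≈⟨ trans (+-inverseˡ-unique _ _ J+X≈0) (sym (+-inverseʳ-unique _ _ X+Y≈0)) ⟩
      (E ⊛ J α β) n
        ≈⟨ ⊛-linearˡ (α 0) 𝟙 (β 1 • z· T) (J α β) n ⟩
      α 0 * (𝟙 ⊛ J α β) n + ((β 1 • z· T) ⊛ J α β) n
        ≈⟨ +-cong (*-congˡ (⊛-identityˡ (J α β) n))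
                  (trans (⊛-•ˡ (β 1) (z· T) (J α β) n) (*-congˡ (⊛-z·ˡ T (J α β) n))) ⟩
      α 0 * J α β n + β 1 * (z· (T ⊛ J α β)) n ∎
      where
      D E : Series
      D i = denominator α β T (suc i)
      E i = α 0 * 𝟙 i + β 1 * (z· T) i

      J+X≈0 : J α β (suc n) + (D ⊛ J α β) n ≈ 0#
      J+X≈0 = trans (+-congʳ (trans (sym (*-identityˡ _)) (*-congʳ (sym D₀≈1)))) (J-unfold α β (suc n))

      X+Y≈0 : (D ⊛ J α β) n + (E ⊛ J α β) n ≈ 0#
      X+Y≈0 = begin
        (D ⊛ J α β) n + (E ⊛ J α β) n         ≈⟨ +-congʳ (*-identityˡ _) ⟨
        1# * (D ⊛ J α β) n + (E ⊛ J α β) n    ≈⟨ ⊛-linearˡ 1# D E (J α β) n ⟨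
        ((λ i → 1# * D i + E i) ⊛ J α β) n    ≈⟨ ⊛-zero (J α β) (λ i → cancel (α 0 * 𝟙 i) (β 1 * (z· T) i)) n ⟩
        0#                                    ∎

  -- Recursive, so that `drop (suc h) f` is by definition `drop h f ∘ suc`, the sequence in the tail
  -- of the continued fraction of `drop h f`.
  drop : ℕ → (ℕ → Carrier) → ℕ → Carrier
  drop zero    f = f
  drop (suc h) f = drop h f ∘ suc

  drop-+ : ∀ h f i → drop h f i ≡ f (i ℕ.+ h)
  drop-+ zero    f i = ≡.cong f (≡.sym (ℕ.+-identityʳ i))
  drop-+ (suc h) f i = ≡.trans (drop-+ h f (suc i)) (≡.cong f (≡.sym (ℕ.+-suc i h)))

  δ : ℕ → Carrier
  δ zero    = 1#
  δ (suc _) = 0#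

  shift : (ℕ → Carrier) → ℕ → Carrier
  shift ψ zero    = 0#
  shift ψ (suc h) = ψ h

  -- paths n h is the total weight of the n-step Motzkin paths from height h to height 0.
  module Motzkin (α up down : ℕ → Carrier) where

    move : (ℕ → Carrier) → ℕ → Carrier
    move ψ h = up h * ψ (suc h) + α h * ψ h + down h * shift ψ h

    move-cong : ∀ {φ ψ} → φ ≋ ψ → move φ ≋ move ψ
    move-cong φ≋ψ zero    = +-congʳ (+-cong (*-congˡ (φ≋ψ 1)) (*-congˡ (φ≋ψ 0)))
    move-cong φ≋ψ (suc h) =
      +-cong (+-cong (*-congˡ (φ≋ψ (suc (suc h)))) (*-congˡ (φ≋ψ (suc h)))) (*-congˡ (φ≋ψ h))

    paths : ℕ → ℕ → Carrier
    paths zero    = δ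
    paths (suc n) = move (paths n)

    module _ (β : ℕ → Carrier) (β≈ : ∀ h → β (suc h) ≈ up h * down (suc h)) where

      private
        Jₕ : ℕ → Series
        Jₕ h = J (drop h α) (drop h β)

      -- The first-passage decomposition of paths from h to 0 gives
      -- Φ h = zʰ Jₕ (down h) Jₕ₋₁ ⋯ (down 1) J₀.
      Φ : ℕ → Series
      Φ zero    = Jₕ 0
      Φ (suc h) = z· down (suc h) • (Jₕ (suc h) ⊛ Φ h)

      private
        Jₕ-suc : ∀ h n → Jₕ h (suc n) ≈
                 α h * Jₕ h n + up h * down (suc h) * (z· (Jₕ (suc h) ⊛ Jₕ h)) n
        Jₕ-suc h n = trans (J-suc (drop h α) (drop h β) n)
          (+-cong (*-congʳ (reflexive (drop-+ h α 0)))
                  (*-congʳ (trans (reflexive (drop-+ h β 1)) (β≈ h))))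

        Jₕ⊛-suc : ∀ h Ψ n → (Jₕ h ⊛ Ψ) (suc n) ≈
                  Ψ (suc n) + (α h * (Jₕ h ⊛ Ψ) n +
                    up h * down (suc h) * (z· (Jₕ (suc h) ⊛ (Jₕ h ⊛ Ψ))) n)
        Jₕ⊛-suc h Ψ n = +-cong
          (trans (*-congʳ (J-zero (drop h α) (drop h β))) (*-identityˡ _))
          (begin
            ((Jₕ h ∘ suc) ⊛ Ψ) n
              ≈⟨ ⊛-cong {B = Ψ} (Jₕ-suc h) (λ _ → refl) n ⟩
            ((λ i → α h * Jₕ h i + c * (z· (Jₕ (suc h) ⊛ Jₕ h)) i) ⊛ Ψ) n
              ≈⟨ ⊛-linearˡ (α h) (Jₕ h) (c • z· (Jₕ (suc h) ⊛ Jₕ h)) Ψ n ⟩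
            α h * (Jₕ h ⊛ Ψ) n + ((c • z· (Jₕ (suc h) ⊛ Jₕ h)) ⊛ Ψ) n
              ≈⟨ +-congˡ (⊛-•ˡ c (z· (Jₕ (suc h) ⊛ Jₕ h)) Ψ n) ⟩
            α h * (Jₕ h ⊛ Ψ) n + c * ((z· (Jₕ (suc h) ⊛ Jₕ h)) ⊛ Ψ) n
              ≈⟨ +-congˡ (*-congˡ (trans (⊛-z·ˡ (Jₕ (suc h) ⊛ Jₕ h) Ψ n)
                                         (z·-cong (⊛-assoc (Jₕ (suc h)) (Jₕ h) Ψ) n))) ⟩
            α h * (Jₕ h ⊛ Ψ) n + c * (z· (Jₕ (suc h) ⊛ (Jₕ h ⊛ Ψ))) n ∎)
          where
          c = up h * down (suc h)

        -- In the functional equation of `Jₕ h`, multiplied by the remaining factors of `Φ h`, the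
        -- constant term gives the paths starting with a down step, `α h` a level step and `β` an up
        -- step.
        Φ-suc : ∀ h n → Φ h (suc n) ≈ move (λ k → Φ k n) h
        Φ-suc zero n = begin
          Jₕ 0 (suc n)
            ≈⟨ Jₕ-suc 0 n ⟩
          α 0 * Jₕ 0 n + up 0 * down 1 * (z· (Jₕ 1 ⊛ Jₕ 0)) n
            ≈⟨ solve 6 (λ a j u d x e → a :* j :+ u :* d :* x := u :* (d :* x) :+ a :* j :+ e :* con 0)
                 refl (α 0) (Jₕ 0 n) (up 0) (down 1) _ (down 0) ⟩
          up 0 * (down 1 * (z· (Jₕ 1 ⊛ Jₕ 0)) n) + α 0 * Jₕ 0 n + down 0 * 0#
            ≈⟨ +-congʳ (+-congʳ (*-congˡ (z·-• (down 1) (Jₕ 1 ⊛ Jₕ 0) n))) ⟨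
          up 0 * Φ 1 n + α 0 * Jₕ 0 n + down 0 * 0# ∎
        Φ-suc (suc h) zero = begin
          down (suc h) * (Jₕ (suc h) 0 * Φ h 0 + 0#)
            ≈⟨ *-congˡ (trans (+-identityʳ _)
                 (trans (*-congʳ (J-zero (drop (suc h) α) (drop (suc h) β))) (*-identityˡ _))) ⟩
          down (suc h) * Φ h 0
            ≈⟨ solve 3 (λ u a x → x := u :* con 0 :+ a :* con 0 :+ x)
                 refl (up (suc h)) (α (suc h)) _ ⟩
          up (suc h) * 0# + α (suc h) * 0# + down (suc h) * Φ h 0 ∎
        Φ-suc (suc h) (suc n) = begin
          d * Y (suc n)
            ≈⟨ *-congˡ (Jₕ⊛-suc (suc h) (Φ h) n) ⟩
          d * (Φ h (suc n) + (a * Y n + u * d′ * (z· (Jₕ (2 ℕ.+ h) ⊛ Y)) n))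
            ≈⟨ solve 7 (λ d x a y u d′ w → d :* (x :+ (a :* y :+ u :* d′ :* w)) :=
                                           u :* (d′ :* (d :* w)) :+ a :* (d :* y) :+ d :* x)
                 refl d (Φ h (suc n)) a (Y n) u d′ _ ⟩
          u * (d′ * (d * (z· (Jₕ (2 ℕ.+ h) ⊛ Y)) n)) + a * (d * Y n) + d * Φ h (suc n)
            ≈⟨ +-congʳ (+-congʳ (*-congˡ (*-congˡ
                 (trans (⊛-z·•ʳ (Jₕ (2 ℕ.+ h)) d Y n) (z·-• d (Jₕ (2 ℕ.+ h) ⊛ Y) n))))) ⟨
          u * (d′ * (Jₕ (2 ℕ.+ h) ⊛ Φ (suc h)) n) + a * (d * Y n) + d * Φ h (suc n) ∎
          where
          a = α (suc h)
          u = up (suc h)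
          d = down (suc h)
          d′ = down (2 ℕ.+ h)
          Y = Jₕ (suc h) ⊛ Φ h

        paths≈Φ : ∀ n h → paths n h ≈ Φ h n
        paths≈Φ zero    zero    = sym (J-zero α β)
        paths≈Φ zero    (suc h) = refl
        paths≈Φ (suc n) h       = trans (move-cong (paths≈Φ n) h) (sym (Φ-suc h n))

      J-paths : ∀ n → J α β n ≈ paths n 0
      J-paths n = sym (paths≈Φ n 0)

  -- Sums over permutations

  foldr-++ : ∀ xs ys → List.foldr _+_ 0# (xs List.++ ys) ≈ List.foldr _+_ 0# xs + List.foldr _+_ 0# ys
  foldr-++ []       ys = sym (+-identityˡ _)
  foldr-++ (x ∷ xs) ys = trans (+-congˡ (foldr-++ xs ys)) (sym (+-assoc _ _ _))

  ∑S-cong : ∀ n {F G : Permutation′ n → Carrier} → (∀ σ → F σ ≈ G σ) → ∑S n F ≈ ∑S n G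
  ∑S-cong n {F} {G} F≈G = go (S n)
    where
    go : ∀ σs → List.foldr _+_ 0# (List.map F σs) ≈ List.foldr _+_ 0# (List.map G σs)
    go []       = refl
    go (σ ∷ σs) = +-cong (F≈G σ) (go σs)

  ∑S-distribˡ : ∀ n c (F : Permutation′ n → Carrier) → ∑S n (λ σ → c * F σ) ≈ c * ∑S n F
  ∑S-distribˡ n c F = go (S n)
    where
    go : ∀ σs → List.foldr _+_ 0# (List.map (λ σ → c * F σ) σs) ≈ c * List.foldr _+_ 0# (List.map F σs)
    go []       = sym (zeroʳ c)
    go (σ ∷ σs) = trans (+-congˡ (go σs)) (sym (distribˡ c _ _))

  ∑S-suc : ∀ n (F : Permutation′ (suc n) → Carrier) →
           ∑S (suc n) F ≈ ∑[ j < suc n ] ∑S n (F ∘ insert zero j)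
  ∑S-suc n F = go id
    where
    go : ∀ {m} (g : Fin m → Fin (suc n)) →
         List.foldr _+_ 0# (List.map F (List.cartesianProductWith (insert zero) (List.tabulate g) (S n)))
         ≈ ∑[ j < m ] ∑S n (F ∘ insert zero (g j))
    go {zero}  g = refl
    go {suc m} g = begin
      List.foldr _+_ 0# (List.map F (row List.++ rest))
        ≈⟨ reflexive (≡.cong (List.foldr _+_ 0#) (List.map-++ F row rest)) ⟩
      List.foldr _+_ 0# (List.map F row List.++ List.map F rest)
        ≈⟨ foldr-++ (List.map F row) (List.map F rest) ⟩
      List.foldr _+_ 0# (List.map F row) + List.foldr _+_ 0# (List.map F rest)
        ≈⟨ +-cong (reflexive (≡.cong (List.foldr _+_ 0#) (≡.sym (List.map-∘ (S n))))) (go (g ∘ suc)) ⟩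
      ∑S n (F ∘ insert zero (g zero)) + ∑[ j < m ] ∑S n (F ∘ insert zero (g (suc j))) ∎
      where
      row  = List.map (insert zero (g zero)) (S n)
      rest = List.cartesianProductWith (insert zero) (List.tabulate (g ∘ suc)) (S n)

  ^-sum : ∀ y {n} (f : Fin n → ℕ) → y ^ ℕ∑.sum f ≈ ∏.sum (λ k → y ^ f k)
  ^-sum y {zero}  f = refl
  ^-sum y {suc n} f = trans (^-homo-* y (f zero) _) (*-congˡ (^-sum y (f ∘ suc)))

  1^ : ∀ n → 1# ^ n ≈ 1#
  1^ zero    = refl
  1^ (suc n) = trans (*-identityˡ _) (1^ n)

  ∑-factor : ∀ {n} a (c ψ : Fin n → Carrier) →
             ∑[ k < n ] (c k * (a * ψ k)) ≈ a * ∑[ k < n ] (c k * ψ k)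
  ∑-factor {n} a c ψ = trans
    (sum-cong-≋ {n} λ k → solve 3 (λ c a p → c :* (a :* p) := a :* (c :* p)) refl (c k) a (ψ k))
    (sym (*-distribˡ-sum {n} a (λ k → c k * ψ k)))

  -- q-integers and the operators of the letters

  module Weighted (x q : Carrier) where

    -- With the highest power split off, the identities of `shift-N₁` become polynomial in `[ h ]`
    -- and in powers of q treated as independent variables.
    [_] : ℕ → Carrier
    [ zero  ] = 0#
    [ suc n ] = [ n ] + q ^ n

    []-⟨1,q⟩ : ∀ n → [ n ]⟨ 1# , q ⟩ ≈ [ n ]
    []-⟨1,q⟩ n = trans (sum-cong-≋ {n} λ i →
                         trans (*-congʳ (1^ (n ℕ.∸ 1 ℕ.∸ toℕ i))) (*-identityˡ _))
                       (powers n)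
      where
      powers : ∀ n → ∑[ i < n ] (q ^ toℕ i) ≈ [ n ]
      powers zero    = refl
      powers (suc n) = trans (sum-init-last {n} (λ i → q ^ toℕ i))
        (+-cong (trans (sum-cong-≋ {n} λ i → ^-congʳ q (Fin.toℕ-inject₁ i)) (powers n))
                (^-congʳ q (Fin.toℕ-fromℕ n)))

    [suc] : ∀ n → [ suc n ] ≈ 1# + q * [ n ]
    [suc] zero    = trans (+-comm _ _) (+-congˡ (sym (zeroʳ q)))
    [suc] (suc n) = trans (+-congʳ ([suc] n))
      (trans (+-assoc _ _ _) (+-congˡ (sym (distribˡ q _ _))))

    -- Operators on functions of the number h of blocks.  A new block gets x, for
    -- its first descent, and each letter gets q for every block to its right not
    -- adjacent to it, since such a block starts with a descent past the letter.
    C B Q : (ℕ → Carrier) → ℕ → Carrier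
    C ψ h = ψ h + shift ψ h
    B ψ h = x * [ suc h ] * ψ (suc h) + [ h ] * ψ h
    Q ψ h = q ^ h * ψ h

    N₀ A N₁ : (ℕ → Carrier) → ℕ → Carrier
    N₀ ψ   = C (B ψ)
    A ψ    = C (Q ψ)
    N₁ ψ h = N₀ ψ h + A ψ h

    shift-cong : ∀ {φ ψ} → φ ≋ ψ → shift φ ≋ shift ψ
    shift-cong φ≋ψ zero    = refl
    shift-cong φ≋ψ (suc h) = φ≋ψ h

    C-cong : ∀ {φ ψ} → φ ≋ ψ → C φ ≋ C ψ
    C-cong φ≋ψ h = +-cong (φ≋ψ h) (shift-cong φ≋ψ h)

    B-cong : ∀ {φ ψ} → φ ≋ ψ → B φ ≋ B ψ
    B-cong φ≋ψ h = +-cong (*-congˡ (φ≋ψ (suc h))) (*-congˡ (φ≋ψ h))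

    N₀-cong : ∀ {φ ψ} → φ ≋ ψ → N₀ φ ≋ N₀ ψ
    N₀-cong = C-cong ∘ B-cong

    N₀-linear : ∀ c φ ψ h → N₀ (λ i → c * φ i + ψ i) h ≈ c * N₀ φ h + N₀ ψ h
    N₀-linear c φ ψ zero    =
      solve 7 (λ c a b f f′ g g′ → (a :* (c :* f′ :+ g′) :+ b :* (c :* f :+ g)) :+ con 0 :=
                 c :* ((a :* f′ :+ b :* f) :+ con 0) :+ ((a :* g′ :+ b :* g) :+ con 0))
        refl c _ _ (φ 0) (φ 1) (ψ 0) (ψ 1)
    N₀-linear c φ ψ (suc h) =
      solve 11 (λ c a b a′ b′ f f′ f″ g g′ g″ →
                 (a :* (c :* f″ :+ g″) :+ b :* (c :* f′ :+ g′)) :+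
                 (a′ :* (c :* f′ :+ g′) :+ b′ :* (c :* f :+ g)) :=
                 c :* ((a :* f″ :+ b :* f′) :+ (a′ :* f′ :+ b′ :* f)) :+
                 ((a :* g″ :+ b :* g′) :+ (a′ :* g′ :+ b′ :* g)))
        refl c _ _ _ _ (φ h) (φ (suc h)) (φ (2 ℕ.+ h)) (ψ h) (ψ (suc h)) (ψ (2 ℕ.+ h))

    N₀-+ : ∀ φ ψ h → N₀ (λ i → φ i + ψ i) h ≈ N₀ φ h + N₀ ψ h
    N₀-+ φ ψ h = begin
      N₀ (λ i → φ i + ψ i) h         ≈⟨ N₀-cong (λ i → +-congʳ (*-identityˡ (φ i))) h ⟨
      N₀ (λ i → 1# * φ i + ψ i) h    ≈⟨ N₀-linear 1# φ ψ h ⟩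
      1# * N₀ φ h + N₀ ψ h           ≈⟨ +-congʳ (*-identityˡ _) ⟩
      N₀ φ h + N₀ ψ h                ∎

    N₀-zero : ∀ h → N₀ (λ _ → 0#) h ≈ 0#
    N₀-zero zero    =
      solve 2 (λ a b → (a :* con 0 :+ b :* con 0) :+ con 0 := con 0) refl _ _
    N₀-zero (suc h) =
      solve 4 (λ a b a′ b′ → (a :* con 0 :+ b :* con 0) :+ (a′ :* con 0 :+ b′ :* con 0) := con 0)
        refl _ _ _ _

    N₀-∑ : ∀ {n} (c : Fin n → Carrier) (ψ : Fin n → ℕ → Carrier) h →
           N₀ (λ i → ∑[ k < n ] (c k * ψ k i)) h ≈ ∑[ k < n ] (c k * N₀ (ψ k) h)
    N₀-∑ {zero}  c ψ h = N₀-zero h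
    N₀-∑ {suc n} c ψ h =
      trans (N₀-linear (c zero) (ψ zero) (λ i → ∑[ k < n ] (c (suc k) * ψ (suc k) i)) h)
            (+-congˡ (N₀-∑ (c ∘ suc) (ψ ∘ suc) h))

    -- Since `C` commutes with `shift`, this is `C` applied to `B (shift ψ) = shift (B ψ) + x Q ψ +
    -- shift (Q ψ)`, which holds because consecutive q-integers differ by a power of q. `C` and
    -- `shift` together reach two heights down, hence the three cases.
    shift-N₁ : ∀ ψ h → shift (N₁ ψ) h + x * A ψ h ≈ N₀ (shift ψ) h
    shift-N₁ ψ zero          =
      solve 3 (λ x e p → con 0 :+ x :* (e :* p :+ con 0) :=
                         (x :* (con 0 :+ e) :* p :+ con 0 :* con 0) :+ con 0)
        refl x (q ^ 0) (ψ 0)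
    shift-N₁ ψ (suc zero)    =
      solve 5 (λ x e₀ e₁ p₀ p₁ →
          ((x :* (con 0 :+ e₀) :* p₁ :+ con 0 :* p₀) :+ con 0) :+ (e₀ :* p₀ :+ con 0)
          :+ x :* (e₁ :* p₁ :+ e₀ :* p₀) :=
          (x :* (con 0 :+ e₀ :+ e₁) :* p₁ :+ (con 0 :+ e₀) :* p₀) :+
          (x :* (con 0 :+ e₀) :* p₀ :+ con 0 :* con 0))
        refl x (q ^ 0) (q ^ 1) (ψ 0) (ψ 1)
    shift-N₁ ψ (suc (suc h)) =
      solve 8 (λ x b e₀ e₁ e₂ p₀ p₁ p₂ →
          ((x :* (b :+ e₀ :+ e₁) :* p₂ :+ (b :+ e₀) :* p₁) :+ (x :* (b :+ e₀) :* p₁ :+ b :* p₀))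
          :+ (e₁ :* p₁ :+ e₀ :* p₀) :+ x :* (e₂ :* p₂ :+ e₁ :* p₁) :=
          (x :* (b :+ e₀ :+ e₁ :+ e₂) :* p₂ :+ (b :+ e₀ :+ e₁) :* p₁) :+
          (x :* (b :+ e₀ :+ e₁) :* p₁ :+ (b :+ e₀) :* p₀))
        refl x [ h ] (q ^ h) (q ^ suc h) (q ^ suc (suc h)) (ψ h) (ψ (suc h)) (ψ (suc (suc h)))

    -- Read upwards, the letters of the part of the permutation still to come form h
    -- blocks (maximal runs of consecutive positions occupied by the free letters
    -- read so far), which must end up as a single block starting with the current
    -- letter: run w j handles the letters of w with j current, and run₁ those above
    -- the current letter, where h does not count the block of the current letter.
    -- In run₀ there is no current letter, so that no free letter can lead to h = 0.
    run₀ run₁ : ∀ {n} → Letters n → ℕ → Carrier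
    run₀ []       = δ
    run₀ (free w) = N₀ (run₀ w)
    run₀ (used w) = Q (run₀ w)
    run₁ []       = δ
    run₁ (free w) = N₁ (run₁ w)
    run₁ (used w) = Q (run₁ w)

    run : ∀ {n} → Letters n → Fin n → ℕ → Carrier
    run (used w) j       = Q (run w j)
    run (free w) zero    = A (run₁ w)
    run (free w) (suc j) = N₀ (run w j)

    -- At height 0 the coefficient `[ 0 ] = 0` in `B` kills any function supported there, so `N₀`
    -- sends it to 0. With the next two lemmas, `run₀ w` is `δ` if `w` has no free letter, and 0
    -- otherwise.
    run₀-suc : ∀ {n} (w : Letters n) h → run₀ w (suc h) ≈ 0#
    run₀-suc []       h       = refl
    run₀-suc (used w) h       = trans (*-congˡ (run₀-suc w h)) (zeroʳ _)
    run₀-suc (free w) zero    =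
      trans (+-cong (+-cong (*-congˡ (run₀-suc w 1)) (*-congˡ (run₀-suc w 0)))
                    (+-congʳ (*-congˡ (run₀-suc w 0))))
            (solve 4 (λ a b c d → (a :* con 0 :+ b :* con 0) :+ (c :* con 0 :+ con 0 :* d) := con 0)
              refl _ _ _ _)
    run₀-suc (free w) (suc h) =
      trans (+-cong (+-cong (*-congˡ (run₀-suc w (2 ℕ.+ h))) (*-congˡ (run₀-suc w (suc h))))
                    (+-cong (*-congˡ (run₀-suc w (suc h))) (*-congˡ (run₀-suc w h))))
            (solve 4 (λ a b c d → (a :* con 0 :+ b :* con 0) :+ (c :* con 0 :+ d :* con 0) := con 0)
              refl _ _ _ _)

    run₀-zero : ∀ {n} (w : Letters (suc n)) → run₀ w 0 ≈ 0#
    run₀-zero (used w) = trans (*-congˡ (run₀-zero w)) (zeroʳ _)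
    run₀-zero (free w) =
      trans (+-congʳ (+-congʳ (*-congˡ (run₀-suc w 0))))
            (solve 2 (λ a b → (a :* con 0 :+ con 0 :* b) :+ con 0 := con 0) refl _ _)

    run₀-one : (w : Letters 0) → run₀ w 0 ≈ 1#
    run₀-one []       = refl
    run₀-one (used w) = trans (*-identityˡ _) (run₀-one w)

    -- The factor contributed by the consecutive entries i, j, where in a descent
    -- q counts the used letters (occurring earlier) between the two.
    step : ∀ {n} → Letters n → Fin n → Fin n → Carrier
    step (used w) i       j       = step w i j
    step (free w) zero    j       = 1#
    step (free w) (suc i) zero    = x * q ^ below w i
    step (free w) (suc i) (suc j) = step w i j


    -- Once `j` is used, a later descent passes it exactly when `j` is the 2 of an occurrence with
    -- that descent as its 31.
    step-use : ∀ {n} (w : Letters (suc n)) j k l →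
      step (use w j) k l ≈
      step w (punchIn j k) (punchIn j l) * q ^ indicator (crosses? j (punchIn j k) (punchIn j l))
    step-use         (used w) j       k       l       = step-use w j k l
    step-use         (free w) zero    k       l       = sym (*-identityʳ _)
    step-use {suc n} (free w) (suc j) zero    zero    = sym (*-identityʳ _)
    step-use {suc n} (free w) (suc j) zero    (suc l)
      rewrite ∧-zeroʳ (does (punchIn j l Fin.<? j))   = sym (*-identityʳ _)
    step-use {suc n} (free w) (suc j) (suc k) zero    = begin
      x * q ^ below (use w j) k
        ≈⟨ *-congˡ (trans (^-congʳ q (below-use w j k)) (^-homo-* q (indicator (j Fin.<? punchIn j k)) _)) ⟩
      x * (q ^ indicator (j Fin.<? punchIn j k) * q ^ below w (punchIn j k))
        ≈⟨ solve 3 (λ x a b → x :* (a :* b) := x :* b :* a) refl x _ _ ⟩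
      x * q ^ below w (punchIn j k) * q ^ indicator (j Fin.<? punchIn j k) ∎
    step-use {suc n} (free w) (suc j) (suc k) (suc l) = step-use w j k l

    -- Total weights and their recursion over the next entry

    weight : ∀ {n} → Letters (suc n) → Permutation′ (suc n) → Carrier
    weight w σ = ∏.sum (λ k → step w (σ ⟨$⟩ʳ inject₁ k) (σ ⟨$⟩ʳ suc k)) * q ^ occ₂₋₃₁ σ

    -- The occurrences with the first entry `j` as 2 move from `occ₂₋₃₁` into the steps, where `j`
    -- has become a used letter.
    weight-insert : ∀ {n} (w : Letters (suc (suc n))) j π →
      weight w (insert zero j π) ≈ step w j (punchIn j (π ⟨$⟩ʳ zero)) * weight (use w j) π
    weight-insert {n} w j π = begin
      step w j (σ ⟨$⟩ʳ suc zero) *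
      ∏.sum (λ k → step w (σ ⟨$⟩ʳ suc (inject₁ k)) (σ ⟨$⟩ʳ suc (suc k))) * q ^ occ₂₋₃₁ σ
        ≈⟨ *-cong
             (*-cong (reflexive (≡.cong (step w j) (σ-suc zero)))
                     (∏.sum-cong-≋ {n} λ k →
                       reflexive (≡.cong₂ (step w) (σ-suc (inject₁ k)) (σ-suc (suc k)))))
             (trans (^-congʳ q (occ-insert j π))
               (trans (^-homo-* q (ℕ∑.sum (crossing j π)) (occ₂₋₃₁ π))
                      (*-congʳ (^-sum q (crossing j π))))) ⟩
      s * ∏.sum u * (∏.sum v * q ^ occ₂₋₃₁ π)
        ≈⟨ solve 4 (λ s u v o → s :* u :* (v :* o) := s :* (u :* v :* o)) refl s _ _ _ ⟩
      s * (∏.sum u * ∏.sum v * q ^ occ₂₋₃₁ π)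
        ≈⟨ *-congˡ (*-congʳ (∏.∑-distrib-+ u v)) ⟨
      s * (∏.sum (λ k → u k * v k) * q ^ occ₂₋₃₁ π)
        ≈⟨ *-congˡ (*-congʳ (∏.sum-cong-≋ {n} λ k → step-use w j (π ⟨$⟩ʳ inject₁ k) (π ⟨$⟩ʳ suc k))) ⟨
      s * weight (use w j) π ∎
      where
      σ = insert zero j π
      σ-suc : ∀ k → σ ⟨$⟩ʳ suc k ≡ punchIn j (π ⟨$⟩ʳ k)
      σ-suc = insert-punchIn zero j π
      s = step w j (punchIn j (π ⟨$⟩ʳ zero))
      u v : Fin n → Carrier
      u k = step w (punchIn j (π ⟨$⟩ʳ inject₁ k)) (punchIn j (π ⟨$⟩ʳ suc k))
      v k = q ^ crossing j π k

    -- Expand the product of the `N₁ = N₀ + A` by the lowest letter contributing `A`: below it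
    -- stands `N₀`, above it `N₁`, and `run₀` is the term without `A`. The factor `1#` is the step
    -- of an ascent into `k`.
    ∑-run : ∀ {n} (w : Letters n) h →
            ∑[ k < n ] (1# * run w k h) + run₀ w h ≈ run₁ w h
    ∑-run []       h = +-identityˡ _
    ∑-run {n} (used w) h = begin
      ∑[ k < n ] (1# * (q ^ h * run w k h)) + q ^ h * run₀ w h
        ≈⟨ +-congʳ (∑-factor (q ^ h) (λ _ → 1#) (λ k → run w k h)) ⟩
      q ^ h * ∑[ k < n ] (1# * run w k h) + q ^ h * run₀ w h
        ≈⟨ distribˡ (q ^ h) _ _ ⟨
      q ^ h * (∑[ k < n ] (1# * run w k h) + run₀ w h)
        ≈⟨ *-congˡ (∑-run w h) ⟩
      q ^ h * run₁ w h ∎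
    ∑-run {suc n} (free w) h = begin
      1# * A (run₁ w) h + ∑[ k < n ] (1# * N₀ (run w k) h) + N₀ (run₀ w) h
        ≈⟨ +-congʳ (+-cong (*-identityˡ _) (sym (N₀-∑ (λ _ → 1#) (run w) h))) ⟩
      A (run₁ w) h + N₀ r h + N₀ (run₀ w) h
        ≈⟨ solve 3 (λ a b c → a :+ b :+ c := (b :+ c) :+ a) refl _ _ _ ⟩
      N₀ r h + N₀ (run₀ w) h + A (run₁ w) h
        ≈⟨ +-congʳ (N₀-+ r (run₀ w) h) ⟨
      N₀ (λ i → r i + run₀ w i) h + A (run₁ w) h
        ≈⟨ +-congʳ (N₀-cong (∑-run w) h) ⟩
      N₀ (run₁ w) h + A (run₁ w) h ∎
      where
      r : ℕ → Carrier
      r i = ∑[ k < n ] (1# * run w k i)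

    q*shift-Q : ∀ ψ h → q * shift (Q ψ) h ≈ q ^ h * shift ψ h
    q*shift-Q ψ zero    = trans (zeroʳ q) (sym (zeroʳ _))
    q*shift-Q ψ (suc h) = sym (*-assoc _ _ _)

    -- The sum runs over the letter k that follows j.  At h = 0 the first term is 0,
    -- and so is the last if there is a free letter besides j.
    run-step : ∀ {n} (w : Letters (suc n)) j h →
      q ^ below w j * shift (run₁ (use w j)) h +
      (∑[ k < n ] (step w j (punchIn j k) * run (use w j) k h) + run₀ (use w j) h) ≈
      run w j h
    run-step {n} (used w) j h = begin
      q * q ^ below w j * shift (Q (run₁ v)) h + (∑[ k < n ] (s k * (q ^ h * run v k h)) + q ^ h * run₀ v h)
        ≈⟨ +-cong
             (trans (solve 3 (λ q b p → q :* b :* p := b :* (q :* p)) refl q _ _)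
                    (*-congˡ (q*shift-Q (run₁ v) h)))
             (+-congʳ (∑-factor (q ^ h) s (λ k → run v k h))) ⟩
      q ^ below w j * (q ^ h * shift (run₁ v) h) + (q ^ h * ∑[ k < n ] (s k * run v k h) + q ^ h * run₀ v h)
        ≈⟨ solve 5 (λ b e p t r → b :* (e :* p) :+ (e :* t :+ e :* r) := e :* (b :* p :+ (t :+ r)))
             refl _ (q ^ h) _ _ _ ⟩
      q ^ h * (q ^ below w j * shift (run₁ v) h + (∑[ k < n ] (s k * run v k h) + run₀ v h))
        ≈⟨ *-congˡ (run-step w j h) ⟩
      q ^ h * run w j h ∎
      where
      v = use w j
      s : Fin n → Carrier
      s k = step w j (punchIn j k)
    -- The current letter is the lowest free one, so every next entry is an ascent.
    run-step {n} (free w) zero h = begin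
      1# * shift (Q (run₁ w)) h + (∑[ k < n ] (1# * (q ^ h * run w k h)) + q ^ h * run₀ w h)
        ≈⟨ +-cong (*-identityˡ _) (∑-run (used w) h) ⟩
      shift (Q (run₁ w)) h + Q (run₁ w) h
        ≈⟨ +-comm _ _ ⟩
      A (run₁ w) h ∎
    -- Going to the lowest free letter is a descent of weight `x * c`; together with the first term
    -- it forms the left side of `shift-N₁`.
    run-step {suc n} (free w) (suc j) h = begin
      c * shift (N₁ ψ) h + (x * c * A ψ h + ∑[ k < n ] (s k * N₀ (run v k) h) + N₀ (run₀ v) h)
        ≈⟨ solve 6 (λ c m x a t r → c :* m :+ (x :* c :* a :+ t :+ r) := c :* (m :+ x :* a) :+ (t :+ r))
             refl c _ x _ _ _ ⟩
      c * (shift (N₁ ψ) h + x * A ψ h) + (∑[ k < n ] (s k * N₀ (run v k) h) + N₀ (run₀ v) h)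
        ≈⟨ +-cong (*-congˡ (shift-N₁ ψ h)) (+-congʳ (sym (N₀-∑ s (run v) h))) ⟩
      c * N₀ (shift ψ) h + (N₀ r h + N₀ (run₀ v) h)
        ≈⟨ +-congˡ (N₀-+ r (run₀ v) h) ⟨
      c * N₀ (shift ψ) h + N₀ (λ i → r i + run₀ v i) h
        ≈⟨ N₀-linear c (shift ψ) (λ i → r i + run₀ v i) h ⟨
      N₀ (λ i → c * shift ψ i + (r i + run₀ v i)) h
        -- `N₀` mixes heights, so the induction hypothesis must be available at every height and not
        -- only at 0.
        ≈⟨ N₀-cong (run-step w j) h ⟩
      N₀ (run w j) h ∎
      where
      v = use w j
      c = q ^ below w j
      ψ = run₁ v
      s : Fin n → Carrier
      s k = step w j (punchIn j k)
      r : ℕ → Carrier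
      r i = ∑[ k < n ] (s k * run v k i)

    -- Before the lowest letter is read there are no blocks, hence h = 0, where `run-step` becomes
    -- the recursion over the next entry. For the last entry, `run₀` supplies the weight 1 of the
    -- empty continuation.
    ∑S-weight : ∀ n (w : Letters (suc n)) j → ∑S n (weight w ∘ insert zero j) ≈ run w j 0
    ∑S-weight zero w j = begin
      1# * 1# + 0#
        ≈⟨ trans (+-identityʳ _) (*-identityˡ _) ⟩
      1#
        ≈⟨ run₀-one (use w j) ⟨
      run₀ (use w j) 0
        ≈⟨ solve 2 (λ b r → r := b :* con 0 :+ (con 0 :+ r)) refl (q ^ below w j) _ ⟩
      q ^ below w j * 0# + (0# + run₀ (use w j) 0)
        ≈⟨ run-step w j 0 ⟩
      run w j 0 ∎
    ∑S-weight (suc n) w j = begin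
      ∑S (suc n) (weight w ∘ insert zero j)
        ≈⟨ ∑S-cong (suc n) (weight-insert w j) ⟩
      ∑S (suc n) (λ π → step w j (punchIn j (π ⟨$⟩ʳ zero)) * weight v π)
        ≈⟨ ∑S-suc n (λ π → step w j (punchIn j (π ⟨$⟩ʳ zero)) * weight v π) ⟩
      ∑[ k < suc n ] ∑S n (λ ρ → s k * weight v (insert zero k ρ))
        ≈⟨ sum-cong-≋ {suc n} (λ k → trans (∑S-distribˡ n (s k) (weight v ∘ insert zero k))
                                           (*-congˡ (∑S-weight n v k))) ⟩
      ∑[ k < suc n ] (s k * run v k 0)
        ≈⟨ solve 2 (λ b t → t := b :* con 0 :+ (t :+ con 0)) refl (q ^ below w j) _ ⟩
      q ^ below w j * 0# + (∑[ k < suc n ] (s k * run v k 0) + 0#)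
        ≈⟨ +-congˡ (+-congˡ (run₀-zero v)) ⟨
      q ^ below w j * 0# + (∑[ k < suc n ] (s k * run v k 0) + run₀ v 0)
        ≈⟨ run-step w j 0 ⟩
      run w j 0 ∎
      where
      v = use w j
      s : Fin (suc n) → Carrier
      s k = step w j (punchIn j k)

    -- Prepending a maximal entry

    step-allFree : ∀ n k → step (allFree (suc n)) (fromℕ n) (punchIn (fromℕ n) k) ≈ x
    step-allFree (suc n) zero    =
      trans (*-congˡ (^-congʳ q (below-allFree (fromℕ n)))) (*-identityʳ x)
    step-allFree (suc n) (suc k) = step-allFree n k

    -- The only used letter exceeds all others, so no descent passes it and no q appears.
    step-use-allFree : ∀ {n} i j →
      step (use (allFree (suc n)) (fromℕ n)) i j ≈ x ^ indicator (j Fin.<? i)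
    step-use-allFree {suc n} zero    j       = refl
    step-use-allFree {suc n} (suc i) zero    = *-congˡ (^-congʳ q (below-use-allFree i))
    step-use-allFree {suc n} (suc i) (suc j) = step-use-allFree i j

    -- A permutation of n letters is preceded by a fictitious maximal first entry,
    -- which accounts for the additional factor x.
    ∑S-des-occ : ∀ n → des-occ-series x q n ≈ run (allFree (suc n)) (fromℕ n) 0
    ∑S-des-occ zero    = sym (trans (+-identityʳ _) (*-identityˡ _))
    ∑S-des-occ (suc n) = trans
      (∑S-cong (suc n) (λ σ → sym (weight-allFree σ)))
      (∑S-weight (suc n) (allFree (2 ℕ.+ n)) (fromℕ (suc n)))
      where
      weight-allFree : ∀ σ → weight (allFree (2 ℕ.+ n)) (insert zero (fromℕ (suc n)) σ) ≈
                       x ^ (des σ ℕ.+ 1) * q ^ occ₂₋₃₁ σ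
      weight-allFree σ = begin
        weight (allFree (2 ℕ.+ n)) (insert zero (fromℕ (suc n)) σ)
          ≈⟨ weight-insert (allFree (2 ℕ.+ n)) (fromℕ (suc n)) σ ⟩
        step (allFree (2 ℕ.+ n)) (fromℕ (suc n)) (punchIn (fromℕ (suc n)) (σ ⟨$⟩ʳ zero)) *
        weight (use (allFree (2 ℕ.+ n)) (fromℕ (suc n))) σ
          ≈⟨ *-congʳ (step-allFree (suc n) (σ ⟨$⟩ʳ zero)) ⟩
        x * weight (use (allFree (2 ℕ.+ n)) (fromℕ (suc n))) σ
          ≈⟨ *-congˡ (*-congʳ (trans
               (∏.sum-cong-≋ {n} λ k → step-use-allFree (σ ⟨$⟩ʳ inject₁ k) (σ ⟨$⟩ʳ suc k))
               (sym (^-sum x {n} _)))) ⟩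
        x * (x ^ ℕ∑.sum (λ k → indicator ((σ ⟨$⟩ʳ suc k) Fin.<? (σ ⟨$⟩ʳ inject₁ k))) * q ^ occ₂₋₃₁ σ)
          ≈⟨ *-congˡ (*-congʳ (^-congʳ x (des-sum σ))) ⟨
        x * (x ^ des σ * q ^ occ₂₋₃₁ σ)
          ≈⟨ *-assoc x _ _ ⟨
        x ^ suc (des σ) * q ^ occ₂₋₃₁ σ
          ≈⟨ *-congʳ (^-congʳ x (ℕ.+-comm 1 (des σ))) ⟩
        x ^ (des σ ℕ.+ 1) * q ^ occ₂₋₃₁ σ ∎

    -- Comparison with the Motzkin paths of the continued fraction

    private
      α β up : ℕ → Carrier
      α = αᶜ (specialisation x q)
      β = βᶜ (specialisation x q)
      up h = x * [ suc h ]

    open Motzkin α up [_]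

    α≈ : ∀ h → α h ≈ up h + [ h ]
    α≈ h = begin
      x * 1# ^ h + x * q * [ h ]⟨ 1# , q ⟩ + 1# * [ h ]⟨ 1# , q ⟩
        ≈⟨ +-cong (+-cong (*-congˡ (1^ h)) (*-congˡ ([]-⟨1,q⟩ h)))
                  (trans (*-identityˡ _) ([]-⟨1,q⟩ h)) ⟩
      x * 1# + x * q * [ h ] + [ h ]
        ≈⟨ +-congʳ (trans (+-congˡ (*-assoc x q _)) (sym (distribˡ x 1# (q * [ h ])))) ⟩
      x * (1# + q * [ h ]) + [ h ]
        ≈⟨ +-congʳ (*-congˡ ([suc] h)) ⟨
      x * [ suc h ] + [ h ] ∎

    β≈ : ∀ h → β (suc h) ≈ up h * [ suc h ]
    β≈ h = *-cong (*-cong (*-identityʳ x) ([]-⟨1,q⟩ (suc h))) ([]-⟨1,q⟩ (suc h))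

    -- The level weight at h is the sum of the up and down weights at h, so the tridiagonal transfer
    -- operator factors into two bidiagonal ones.
    move≋B∘C : ∀ ψ → move ψ ≋ B (C ψ)
    move≋B∘C ψ h = trans (+-congʳ (+-congˡ (*-congʳ (α≈ h))))
      (solve 5 (λ u b p₀ p₁ s → u :* p₁ :+ (u :+ b) :* p₀ :+ b :* s :=
                                u :* (p₁ :+ p₀) :+ b :* (p₀ :+ s))
        refl (up h) [ h ] (ψ h) (ψ (suc h)) (shift ψ h))

    run-allFree : ∀ n → run (allFree (suc n)) (fromℕ n) ≋ C (paths n)
    -- The single letter contributes `A δ = C (Q δ)`, and `Q δ = δ`.
    run-allFree zero    = C-cong λ { zero → *-identityˡ _ ; (suc h) → zeroʳ _ }
    run-allFree (suc n) h = begin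
      N₀ (run (allFree (suc n)) (fromℕ n)) h  ≈⟨ N₀-cong (run-allFree n) h ⟩
      C (B (C (paths n))) h                   ≈⟨ C-cong (move≋B∘C (paths n)) h ⟨
      C (move (paths n)) h                    ∎

    𝒞-des-occ : 𝒞 (specialisation x q) ≋ des-occ-series x q
    𝒞-des-occ n = begin
      J α β n                              ≈⟨ J-paths β β≈ n ⟩
      -- At height 0 the operator `C` leaves values unchanged, as `shift` is 0 there.
      paths n 0                            ≈⟨ +-identityʳ _ ⟨
      C (paths n) 0                        ≈⟨ run-allFree n 0 ⟨
      run (allFree (suc n)) (fromℕ n) 0    ≈⟨ ∑S-des-occ n ⟨
      des-occ-series x q n                 ∎

corollary6 : ∀ {r₁ r₂} (R : CommutativeRing r₁ r₂) (x q : CommutativeRing.Carrier R) →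
    let open PowerSeries R in 𝒞 (specialisation x q) ≋ des-occ-series x q
corollary6 R x q = Weighted.𝒞-des-occ R x q
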